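{- Let $D_0$ be the edge-ordered graph on the four vertices $a,b,v,w$ with exactly the five edges $ab,av,aw,bw,bv$, ordered by $l(ab)<l(av)<l(aw)<l(bw)<l(bv)$. Then \[ssat_m(n,D_0)\ \le\ sat_m(n,D_0)=O\left(n\,\frac{\log n}{\log\log n}\right).\]
   Context: An edge-ordered graph is a finite simple graph together with a linear order on its edge set given by an injective labeling $l$ to $\mathbb{N}$ or $\mathbb{R}$. An edge-ordered graph $H$ contains $G$ (has a copy of $G$) if $G$ is isomorphic, by an isomorphism respecting the edge-order, to a subgraph of $H$ with the induced order; otherwise $H$ is $G$-free. $ssat_m(n,G)$ is the minimum number of edges in an edge-ordered graph $H$ on $n$ vertices such that adding to $H$ any missing edge, inserted at the beginning of the linear order (i.e. with a label smaller than all labels of $H$), creates a new copy of $G$ (one using the added edge). $sat_m(n,G)$ is defined in the same way with the additional requirement that $H$ is $G$-free. Asymptotic notation is for $n\to\infty$. -}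

module Defs where

open import Data.Bool.Base using (if_then_else_)
open import Data.Fin.Base using (Fin; zero; suc)
open import Data.Fin.Properties as Fin using (all?)
open import Data.List.Base using (List; length; filter; cartesianProduct; allFin)
open import Data.Nat.Base using (ℕ; zero; suc; _*_; _≤_; _<_)
open import Data.Nat.Properties as ℕ using (suc-injective)
open import Data.Product using (Σ-syntax; ∃-syntax; _×_; _,_)
open import Data.Sum.Base using (_⊎_; inj₁; inj₂)
open import Function.Bundles using (_⇔_)
open import Function.Definitions using (Injective)
open import Level using (0ℓ)
open import Relation.Binary.Core using (Rel)
open import Relation.Binary.Definitions using (Decidable; Symmetric; Irreflexive)
open import Relation.Binary.PropositionalEquality
  using (_≡_; _≢_; refl; sym; trans; cong)
open import Relation.Nullary.Decidable
  using (Dec; yes; no; does; from-yes; ¬?; _×-dec_; _⊎-dec_; _→-dec_)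
open import Relation.Nullary.Negation using (¬_; contradiction)

-- {x , y} ≡ {u , v} as unordered pairs.
SamePair : ∀ {n} → (x y u v : Fin n) → Set
SamePair x y u v = (x ≡ u × y ≡ v) ⊎ (x ≡ v × y ≡ u)

samePair? : ∀ {n} (x y u v : Fin n) → Dec (SamePair x y u v)
samePair? x y u v =
  (x Fin.≟ u ×-dec y Fin.≟ v) ⊎-dec (x Fin.≟ v ×-dec y Fin.≟ u)

SamePair-flip : ∀ {n} {x y u v : Fin n} → SamePair x y u v → SamePair y x u v
SamePair-flip (inj₁ (p , q)) = inj₂ (q , p)
SamePair-flip (inj₂ (p , q)) = inj₁ (q , p)

SamePair-join : ∀ {n} {x y x′ y′ u v : Fin n} →
                SamePair x y u v → SamePair x′ y′ u v → SamePair x y x′ y′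
SamePair-join (inj₁ (p , q)) (inj₁ (r , s)) = inj₁ (trans p (sym r) , trans q (sym s))
SamePair-join (inj₁ (p , q)) (inj₂ (r , s)) = inj₂ (trans p (sym s) , trans q (sym r))
SamePair-join (inj₂ (p , q)) (inj₁ (r , s)) = inj₂ (trans p (sym s) , trans q (sym r))
SamePair-join (inj₂ (p , q)) (inj₂ (r , s)) = inj₁ (trans p (sym r) , trans q (sym s))

-- The values of `label` at non-adjacent pairs are irrelevant.
record EdgeOrderedGraph (n : ℕ) : Set₁ where
  infix 4 _~_ _~?_
  field
    _~_             : Rel (Fin n) 0ℓ
    _~?_            : Decidable _~_
    ~-sym           : Symmetric _~_
    ~-irrefl        : Irreflexive _≡_ _~_
    label           : Fin n → Fin n → ℕ
    label-sym       : ∀ {x y} → x ~ y → label x y ≡ label y x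
    label-injective : ∀ {x y x′ y′} → x ~ y → x′ ~ y′ →
                      label x y ≡ label x′ y′ → SamePair x y x′ y′

  edges : List (Fin n × Fin n)
  edges = filter (λ (x , y) → (x Fin.<? y) ×-dec (x ~? y))
                 (cartesianProduct (allFin n) (allFin n))

  size : ℕ
  size = length edges

record Copy {m n} (G : EdgeOrderedGraph m) (H : EdgeOrderedGraph n) : Set where
  private
    module G = EdgeOrderedGraph G
    module H = EdgeOrderedGraph H
  field
    embed           : Fin m → Fin n
    embed-injective : Injective _≡_ _≡_ embed
    embed-edge      : ∀ {x y} → x G.~ y → embed x H.~ embed y
    embed-order     : ∀ {x y x′ y′} → x G.~ y → x′ G.~ y′ →
                      (G.label x y < G.label x′ y′)
                      ⇔ (H.label (embed x) (embed y) < H.label (embed x′) (embed y′))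

  -- The edge uv of H belongs to the copy.
  Uses : Fin n → Fin n → Set
  Uses u v = ∃[ x ] ∃[ y ] x G.~ y × SamePair (embed x) (embed y) u v

Free : ∀ {m n} → EdgeOrderedGraph m → EdgeOrderedGraph n → Set
Free G H = ¬ Copy G H

-- The labels of H are shifted up by one, so that 0 becomes available
-- for the new edge uv; the order on the edges of H is unaffected.
addFirst : ∀ {n} (H : EdgeOrderedGraph n) (u v : Fin n) → u ≢ v → EdgeOrderedGraph n
addFirst {n} H u v u≢v = record
  { _~_             = _~′_
  ; _~?_            = λ x y → (x ~? y) ⊎-dec samePair? x y u v
  ; ~-sym           = sym′
  ; ~-irrefl        = irrefl′
  ; label           = label′
  ; label-sym       = label-sym′
  ; label-injective = label-injective′
  }
  where
  open EdgeOrderedGraph H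

  _~′_ : Rel (Fin n) 0ℓ
  x ~′ y = x ~ y ⊎ SamePair x y u v

  firstLabel : ∀ {A : Set} → Dec A → ℕ → ℕ
  firstLabel new? k = if does new? then 0 else suc k

  label′ : Fin n → Fin n → ℕ
  label′ x y = firstLabel (samePair? x y u v) (label x y)

  sym′ : Symmetric _~′_
  sym′ (inj₁ e) = inj₁ (~-sym e)
  sym′ (inj₂ s) = inj₂ (SamePair-flip s)

  irrefl′ : Irreflexive _≡_ _~′_
  irrefl′ p    (inj₁ e)              = ~-irrefl p e
  irrefl′ refl (inj₂ (inj₁ (p , q))) = u≢v (trans (sym p) q)
  irrefl′ refl (inj₂ (inj₂ (p , q))) = u≢v (trans (sym q) p)

  label-sym′ : ∀ {x y} → x ~′ y → label′ x y ≡ label′ y x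
  label-sym′ {x} {y} e = go e (samePair? x y u v) (samePair? y x u v)
    where
    go : x ~′ y → (p : Dec (SamePair x y u v)) (q : Dec (SamePair y x u v)) →
         firstLabel p (label x y) ≡ firstLabel q (label y x)
    go _        (yes _) (yes _) = refl
    go _        (yes s) (no ¬s) = contradiction (SamePair-flip s) ¬s
    go _        (no ¬s) (yes s) = contradiction (SamePair-flip s) ¬s
    go (inj₁ e) (no _)  (no _)  = cong suc (label-sym e)
    go (inj₂ s) (no ¬s) (no _)  = contradiction s ¬s

  label-injective′ : ∀ {x y x′ y′} → x ~′ y → x′ ~′ y′ →
                     label′ x y ≡ label′ x′ y′ → SamePair x y x′ y′
  label-injective′ {x} {y} {x′} {y′} d e =
    go d e (samePair? x y u v) (samePair? x′ y′ u v)
    where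
    go : x ~′ y → x′ ~′ y′ →
         (p : Dec (SamePair x y u v)) (q : Dec (SamePair x′ y′ u v)) →
         firstLabel p (label x y) ≡ firstLabel q (label x′ y′) → SamePair x y x′ y′
    go _        _        (yes s) (yes t) _  = SamePair-join s t
    go _        _        (yes _) (no _)  ()
    go _        _        (no _)  (yes _) ()
    go (inj₁ d) (inj₁ e) (no _)  (no _)  eq = label-injective d e (suc-injective eq)
    go (inj₂ s) _        (no ¬s) (no _)  _  = contradiction s ¬s
    go (inj₁ _) (inj₂ t) (no _)  (no ¬t) _  = contradiction t ¬t

Semisaturated : ∀ {m n} → EdgeOrderedGraph m → EdgeOrderedGraph n → Set
Semisaturated G H =
  ∀ u v (u≢v : u ≢ v) → ¬ (u ~ v) →
  Σ[ c ∈ Copy G (addFirst H u v u≢v) ] Copy.Uses c u v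
  where open EdgeOrderedGraph H

Saturated : ∀ {m n} → EdgeOrderedGraph m → EdgeOrderedGraph n → Set
Saturated G H = Free G H × Semisaturated G H

IsMinSize : ∀ {n} → (EdgeOrderedGraph n → Set) → ℕ → Set₁
IsMinSize P k = (∃[ H ] P H × EdgeOrderedGraph.size H ≡ k)
              × (∀ H → P H → k ≤ EdgeOrderedGraph.size H)

-- ssatₘ(n , G) ≡ k
Ssatₘ[_,_]≡_ : ∀ {m} → ℕ → EdgeOrderedGraph m → ℕ → Set₁
Ssatₘ[ n , G ]≡ k = IsMinSize {n} (Semisaturated G) k

-- satₘ(n , G) ≡ k
Satₘ[_,_]≡_ : ∀ {m} → ℕ → EdgeOrderedGraph m → ℕ → Set₁
Satₘ[ n , G ]≡ k = IsMinSize {n} (Saturated G) k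

module Diamond where
  pattern a = zero
  pattern b = suc zero
  pattern v = suc (suc zero)
  pattern w = suc (suc (suc zero))

  -- 0 marks the pairs that are not edges.
  l : Fin 4 → Fin 4 → ℕ
  l a b = 1
  l b a = 1
  l a v = 2
  l v a = 2
  l a w = 3
  l w a = 3
  l b w = 4
  l w b = 4
  l b v = 5
  l v b = 5
  l _ _ = 0

  l-sym : ∀ x y → l x y ≡ l y x
  l-sym = from-yes (all? λ x → all? λ y → l x y ℕ.≟ l y x)

  l-loop : ∀ x → ¬ (0 < l x x)
  l-loop = from-yes (all? λ x → ¬? (0 ℕ.<? l x x))

  l-injective : ∀ x y x′ y′ → 0 < l x y → l x y ≡ l x′ y′ → SamePair x y x′ y′
  l-injective = from-yes (all? λ x → all? λ y → all? λ x′ → all? λ y′ →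
    (0 ℕ.<? l x y) →-dec ((l x y ℕ.≟ l x′ y′) →-dec samePair? x y x′ y′))

D₀ : EdgeOrderedGraph 4
D₀ = record
  { _~_             = λ x y → 0 < l x y
  ; _~?_            = λ x y → 0 ℕ.<? l x y
  ; ~-sym           = λ {x} {y} e → ℕ.<-≤-trans e (ℕ.≤-reflexive (l-sym x y))
  ; ~-irrefl        = λ { {x} refl → l-loop x }
  ; label           = l
  ; label-sym       = λ {x} {y} _ → l-sym x y
  ; label-injective = λ {x} {y} {x′} {y′} d _ → l-injective x y x′ y′ d
  }
  where open Diamond

-- f = O(g / h), where h is eventually positive, with the denominator cleared.
_=O[_/_] : (f g h : ℕ → ℕ) → Set
f =O[ g / h ] = ∃[ C ] ∃[ N ] ∀ n → N ≤ n → 0 < h n × f n * h n ≤ C * g n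

{-# OPTIONS --safe #-}

-- Join every other vertex to 2m hubs, with all labels at one vertex below those
-- at the next, and order the hubs differently at different vertices; this is
-- possible when n ≤ m ^ m. The graph is bipartite, hence D₀-free, and two
-- differently ordered vertices lie opposite each other on a 4-cycle with monotone
-- labels, so that joining them first creates a copy of D₀. Adding missing edges
-- greedily therefore only ever adds edges between hubs, and the resulting saturated
-- graph has at most 2mn edges; m is of order log n / log log n. The minima
-- themselves are found by search, since up to order-isomorphism of the labels
-- there are finitely many graphs on n vertices and saturation is decidable.
module Submission where

open import Defs
open import Data.Bool.Base using (if_then_else_)
open import Data.Empty using (⊥)
open import Data.Fin.Base as Fin
  using (Fin; zero; suc; toℕ; fromℕ<; finToFun; funToFin; combine; splitAt; _↑ˡ_; _↑ʳ_; inject≤)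
import Data.Fin.Properties as Fin
open import Data.List.Base
  using (List; []; _∷_; _++_; length; filter; map; tabulate; cartesianProduct; allFin)
open import Data.List.Membership.Propositional using (_∈_)
open import Data.List.Membership.Propositional.Properties
  using (∈-cartesianProduct⁺; ∈-cartesianProduct⁻; ∈-allFin; ∈-tabulate⁻)
open import Data.List.Properties
  using (length-filter; length-++; length-map; length-tabulate; filter-++; filter-none;
         cartesianProductWith-distribʳ-++; ++-identityʳ)
open import Data.List.Relation.Unary.All as All using (All)
open import Data.List.Relation.Unary.Any using (here; there)
open import Data.Nat
open import Data.Nat.DivMod using (m≡m%n+[m/n]*n; m%n<n; m/n*n≤m; m*n/n≡m; /-monoˡ-≤)
open import Data.Nat.Induction using (<-rec)
open import Data.Nat.Logarithm
  using (⌊log₂_⌋; ⌊log₂⌋-mono-≤; ⌊log₂⌊n/2⌋⌋≡⌊log₂n⌋∸1; ⌊log₂[2^n]⌋≡n)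
open import Data.Nat.Properties
open import Data.Nat.Tactic.RingSolver using (solve-∀)
open import Data.Product using (Σ-syntax; ∃-syntax; _×_; _,_; proj₁; proj₂; map₂)
open import Data.Sum.Base using (_⊎_; inj₁; inj₂; [_,_]′)
open import Data.Unit.Base using (⊤; tt)
open import Function.Base using (id; _∘_)
open import Function.Bundles using (mk⇔; module Equivalence)
open import Level using (Level)
open import Relation.Binary.Definitions using (tri<; tri≈; tri>)
open import Relation.Binary.PropositionalEquality
open import Relation.Nullary.Decidable
  using (Dec; yes; no; does; from-yes; dec-true; dec-false; decidable-stable; map′;
         ¬?; _×-dec_; _⊎-dec_; _→-dec_)
open import Relation.Nullary.Negation using (¬_; contradiction)
open import Relation.Unary using (Pred; Decidable)

open EdgeOrderedGraph

private variable
  ℓ p q : Level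
  c k m n r t : ℕ

-- Filters, finite function spaces and unordered pairs

module _ {A : Set} {P : Pred A p} {Q : Pred A q} (P? : Decidable P) (Q? : Decidable Q)
         (P⊆Q : ∀ {x} → P x → Q x) where

  length-filter-mono-≤ : ∀ xs → length (filter P? xs) ≤ length (filter Q? xs)
  length-filter-mono-≤ [] = z≤n
  length-filter-mono-≤ (x ∷ xs) with P? x | Q? x
  ... | yes _  | yes _  = s≤s (length-filter-mono-≤ xs)
  ... | yes px | no ¬qx = contradiction (P⊆Q px) ¬qx
  ... | no _   | yes _  = m≤n⇒m≤1+n (length-filter-mono-≤ xs)
  ... | no _   | no _   = length-filter-mono-≤ xs

  -- The strict form makes the greedy process terminate and ranks of labels strictly increasing.
  length-filter-mono-< : ∀ {x xs} → x ∈ xs → Q x → ¬ P x →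
                         length (filter P? xs) < length (filter Q? xs)
  length-filter-mono-< {x} {.x ∷ xs} (here refl) qx ¬px with P? x | Q? x
  ... | yes px | _      = contradiction px ¬px
  ... | no _   | yes _  = s≤s (length-filter-mono-≤ xs)
  ... | no _   | no ¬qx = contradiction qx ¬qx
  length-filter-mono-< {x} {y ∷ xs} (there x∈xs) qx ¬px with P? y | Q? y
  ... | yes _  | yes _  = s<s (length-filter-mono-< x∈xs qx ¬px)
  ... | yes py | no ¬qy = contradiction (P⊆Q py) ¬qy
  ... | no _   | yes _  = m≤n⇒m≤1+n (length-filter-mono-< x∈xs qx ¬px)
  ... | no _   | no _   = length-filter-mono-< x∈xs qx ¬px

funToFin-cong : {f g : Fin m → Fin n} → f ≗ g → funToFin f ≡ funToFin g
funToFin-cong {zero}  f≗g = refl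
funToFin-cong {suc m} f≗g = cong₂ Fin.combine (f≗g zero) (funToFin-cong (f≗g ∘ suc))

-- Turns distinct codes into functions that differ at some argument; this is how outer vertices are
-- told apart later.
finToFun-injective : {i j : Fin (n ^ m)} → finToFun {n} {m} i ≗ finToFun j → i ≡ j
finToFun-injective {n} {m} {i} {j} eq = begin
  i                              ≡⟨ Fin.funToFin-finToFin {m} {n} i ⟨
  funToFin (finToFun {n} {m} i)  ≡⟨ funToFin-cong eq ⟩
  funToFin (finToFun {n} {m} j)  ≡⟨ Fin.funToFin-finToFin {m} {n} j ⟩
  j                              ∎
  where open ≡-Reasoning

-- Functions are enumerated through their codes in `Fin (n ^ m)`. Decoding recovers a function only
-- pointwise, so `P` has to respect `_≗_`.
∃fun? : {P : Pred (Fin m → Fin n) p} → (∀ {f g} → f ≗ g → P f → P g) →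
        Decidable P → Dec (∃[ f ] P f)
∃fun? {m} {n} resp P? = map′
  (λ (_ , pf) → _ , pf)
  (λ (f , pf) → funToFin f , resp (λ x → sym (Fin.finToFun-funToFin f x)) pf)
  (Fin.any? (P? ∘ finToFun {n} {m}))

least : {P : Pred ℕ ℓ} → Decidable P → ∀ k → P k →
        ∃[ k ] P k × (∀ {j} → P j → k ≤ j)
least P? zero    p = zero , p , λ _ → z≤n
least {P = P} P? (suc k) p with P? zero
... | yes p₀ = zero , p₀ , λ _ → z≤n
... | no ¬p₀ with least (P? ∘ suc) k p
...   | k′ , p′ , min = suc k′ , p′ , min′
  where
  min′ : ∀ {j} → P j → suc k′ ≤ j
  min′ {zero}  p₀ = contradiction p₀ ¬p₀
  min′ {suc j} pj = s≤s (min pj)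

SamePair-sym : {x y u v : Fin n} → SamePair x y u v → SamePair u v x y
SamePair-sym (inj₁ (refl , refl)) = inj₁ (refl , refl)
SamePair-sym (inj₂ (refl , refl)) = inj₂ (refl , refl)

SamePair-trans : {x y u v s t : Fin n} → SamePair x y u v → SamePair u v s t → SamePair x y s t
SamePair-trans p q = SamePair-join p (SamePair-sym q)

SamePair-map : {x y u v : Fin n} (f : Fin n → Fin m) →
               SamePair x y u v → SamePair (f x) (f y) (f u) (f v)
SamePair-map f (inj₁ (p , q)) = inj₁ (cong f p , cong f q)
SamePair-map f (inj₂ (p , q)) = inj₂ (cong f p , cong f q)

~-resp : (H : EdgeOrderedGraph n) → ∀ {x y u v} → SamePair x y u v → _~_ H x y → _~_ H u v
~-resp H (inj₁ (refl , refl)) e = e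
~-resp H (inj₂ (refl , refl)) e = ~-sym H e

label-resp : (H : EdgeOrderedGraph n) → ∀ {x y u v} → SamePair x y u v → _~_ H x y →
             label H x y ≡ label H u v
label-resp H (inj₁ (refl , refl)) e = refl
label-resp H (inj₂ (refl , refl)) e = label-sym H e

-- Copies and saturation

-- A form of `Copy` for a fixed map, made of finite quantifiers and implications, so that it can be
-- decided by search.
record IsCopy (G : EdgeOrderedGraph m) (H : EdgeOrderedGraph n) (f : Fin m → Fin n) : Set where
  field
    injective : ∀ x y → f x ≡ f y → x ≡ y
    edge      : ∀ x y → _~_ G x y → _~_ H (f x) (f y)
    mono      : ∀ x y x′ y′ → _~_ G x y → _~_ G x′ y′ → label G x y < label G x′ y′ →
                label H (f x) (f y) < label H (f x′) (f y′)

open IsCopy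

module _ {G : EdgeOrderedGraph m} {H : EdgeOrderedGraph n} where

  isCopy : (c : Copy G H) → IsCopy G H (Copy.embed c)
  isCopy c = record
    { injective = λ _ _ → Copy.embed-injective c
    ; edge      = λ _ _ → Copy.embed-edge c
    ; mono      = λ _ _ _ _ d e → Equivalence.to (Copy.embed-order c d e)
    }

  -- The order is reflected because the labels of `G` are totally ordered: equal labels mean one
  -- edge, whose image has one label, and a reversed inequality would be preserved by `mono`.
  copy : {f : Fin m → Fin n} → IsCopy G H f → Copy G H
  copy {f} c = record
    { embed           = f
    ; embed-injective = injective c _ _
    ; embed-edge      = edge c _ _
    ; embed-order     = λ d e → mk⇔ (mono c _ _ _ _ d e) (reflects d e)
    }
    where
    reflects : ∀ {x y x′ y′} → _~_ G x y → _~_ G x′ y′ →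
               label H (f x) (f y) < label H (f x′) (f y′) → label G x y < label G x′ y′
    reflects {x} {y} {x′} {y′} d e lt with <-cmp (label G x y) (label G x′ y′)
    ... | tri< l<l′ _ _ = l<l′
    ... | tri≈ _ l≡l′ _ = contradiction lt
      (<-irrefl (label-resp H (SamePair-map f (label-injective G d e l≡l′)) (edge c _ _ d)))
    ... | tri> _ _ l>l′ = contradiction lt (<-asym (mono c _ _ _ _ e d l>l′))

  IsCopy-resp : {f g : Fin m → Fin n} → f ≗ g → IsCopy G H f → IsCopy G H g
  IsCopy-resp f≗g c = record
    { injective = λ x y eq → injective c x y (trans (f≗g x) (trans eq (sym (f≗g y))))
    ; edge      = λ x y e → subst₂ (_~_ H) (f≗g x) (f≗g y) (edge c x y e)
    ; mono      = λ x y x′ y′ d e lt →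
        subst₂ _<_ (cong₂ (label H) (f≗g x) (f≗g y)) (cong₂ (label H) (f≗g x′) (f≗g y′))
          (mono c x y x′ y′ d e lt)
    }

  isCopy? : Decidable (IsCopy G H)
  isCopy? f = map′
    (λ (i , e , o) → record { injective = i ; edge = e ; mono = o })
    (λ c → injective c , edge c , mono c)
    (     (Fin.all? λ x → Fin.all? λ y → (f x Fin.≟ f y) →-dec (x Fin.≟ y))
    ×-dec (Fin.all? λ x → Fin.all? λ y → _~?_ G x y →-dec _~?_ H (f x) (f y))
    ×-dec (Fin.all? λ x → Fin.all? λ y → Fin.all? λ x′ → Fin.all? λ y′ →
            _~?_ G x y →-dec (_~?_ G x′ y′ →-dec
              ((label G x y <? label G x′ y′) →-dec
               (label H (f x) (f y) <? label H (f x′) (f y′))))))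

IsCopy-∘ : {F : EdgeOrderedGraph k} {G : EdgeOrderedGraph m} {H : EdgeOrderedGraph n}
           {f : Fin k → Fin m} {g : Fin m → Fin n} →
           IsCopy G H g → IsCopy F G f → IsCopy F H (g ∘ f)
IsCopy-∘ c d = record
  { injective = λ x y eq → injective d x y (injective c _ _ eq)
  ; edge      = λ x y e → edge c _ _ (edge d x y e)
  ; mono      = λ x y x′ y′ e e′ lt →
      mono c _ _ _ _ (edge d x y e) (edge d x′ y′ e′) (mono d x y x′ y′ e e′ lt)
  }

infix 4 _⊑_
-- Subgraph on the same vertices with the induced edge order; in both directions it says that the
-- labellings are order-isomorphic.
_⊑_ : EdgeOrderedGraph n → EdgeOrderedGraph n → Set
H ⊑ H′ = IsCopy H H′ id

⊑-refl : {H : EdgeOrderedGraph n} → H ⊑ H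
⊑-refl = record
  { injective = λ _ _ eq → eq ; edge = λ _ _ e → e ; mono = λ _ _ _ _ _ _ lt → lt }

module _ (H : EdgeOrderedGraph n) {u v : Fin n} (u≢v : u ≢ v) where

  label-new : ∀ {x y} → SamePair x y u v → label (addFirst H u v u≢v) x y ≡ 0
  label-new {x} {y} s =
    cong (if_then 0 else suc (label H x y)) (dec-true (samePair? x y u v) s)

  label-old : ∀ {x y} → ¬ SamePair x y u v →
              label (addFirst H u v u≢v) x y ≡ suc (label H x y)
  label-old {x} {y} ¬s =
    cong (if_then 0 else suc (label H x y)) (dec-false (samePair? x y u v) ¬s)

  ⊑-addFirst : ¬ _~_ H u v → H ⊑ addFirst H u v u≢v
  ⊑-addFirst u≁v = record
    { injective = λ _ _ eq → eq
    ; edge      = λ _ _ → inj₁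
    ; mono      = λ x y x′ y′ d e lt →
        subst₂ _<_ (sym (label-old (old d))) (sym (label-old (old e))) (s<s lt)
    }
    where
    old : ∀ {x y} → _~_ H x y → ¬ SamePair x y u v
    old d s = u≁v (~-resp H s d)

-- The new edge comes first on both sides, and all other labels are shifted by one alike.
addFirst-mono : {H H′ : EdgeOrderedGraph n} {u v u′ v′ : Fin n} (u≢v : u ≢ v) (u′≢v′ : u′ ≢ v′) →
                H ⊑ H′ → SamePair u v u′ v′ → ¬ _~_ H′ u′ v′ →
                addFirst H u v u≢v ⊑ addFirst H′ u′ v′ u′≢v′
addFirst-mono {n} {H} {H′} {u} {v} {u′} {v′} u≢v u′≢v′ H⊑H′ uv u≁v = record
  { injective = λ _ _ eq → eq
  ; edge      = λ { x y (inj₁ e) → inj₁ (edge H⊑H′ x y e) ; _ _ (inj₂ s) → inj₂ (new s) }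
  ; mono      = order
  }
  where
  new : ∀ {x y} → SamePair x y u v → SamePair x y u′ v′
  new s = SamePair-trans s uv

  new⁻¹ : ∀ {x y} → ¬ SamePair x y u v → ¬ SamePair x y u′ v′
  new⁻¹ ¬s s = ¬s (SamePair-trans s (SamePair-sym uv))

  old : ∀ {x y} → _~_ H x y ⊎ SamePair x y u v → ¬ SamePair x y u v → _~_ H x y
  old (inj₁ e) _  = e
  old (inj₂ s) ¬s = contradiction s ¬s

  A = addFirst H u v u≢v
  B = addFirst H′ u′ v′ u′≢v′

  order : ∀ x y x′ y′ → _~_ A x y → _~_ A x′ y′ →
          label A x y < label A x′ y′ → label B x y < label B x′ y′
  -- The larger edge cannot be the new one, since nothing lies below label 0.
  order x y x′ y′ d e lt with samePair? x′ y′ u v | samePair? x y u v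
  ... | yes s | _     = contradiction (subst (label A x y <_) (label-new H u≢v {x′} {y′} s) lt) n≮0
  ... | no ¬s | yes t = subst₂ _<_ (sym (label-new H′ u′≢v′ (new t)))
                                   (sym (label-old H′ u′≢v′ (new⁻¹ ¬s))) z<s
  ... | no ¬s | no ¬t =
    subst₂ _<_ (sym (label-old H′ u′≢v′ (new⁻¹ ¬t))) (sym (label-old H′ u′≢v′ (new⁻¹ ¬s)))
      (s<s (mono H⊑H′ _ _ _ _ (old d ¬t) (old e ¬s)
        (s<s⁻¹ (subst₂ _<_ (label-old H u≢v ¬t) (label-old H u≢v ¬s) lt))))

Completes : EdgeOrderedGraph m → (H : EdgeOrderedGraph n) (u v : Fin n) → u ≢ v → Set
Completes G H u v u≢v = Σ[ c ∈ Copy G (addFirst H u v u≢v) ] Copy.Uses c u v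

-- The new edge precedes everything in either graph, so the copy carries over. With `⊑-refl` this
-- also swaps the endpoints or replaces the proof of `u ≢ v`.
Completes-mono : {G : EdgeOrderedGraph m} {H H′ : EdgeOrderedGraph n} {u v u′ v′ : Fin n}
                 {u≢v : u ≢ v} {u′≢v′ : u′ ≢ v′} →
                 H ⊑ H′ → SamePair u v u′ v′ → ¬ _~_ H′ u′ v′ →
                 Completes G H u v u≢v → Completes G H′ u′ v′ u′≢v′
Completes-mono H⊑H′ uv u≁v (c , x , y , e , s) =
    copy (IsCopy-∘ (addFirst-mono _ _ H⊑H′ uv u≁v) (isCopy c))
  , x , y , e , SamePair-trans s uv

module _ (G : EdgeOrderedGraph m) (H : EdgeOrderedGraph n) where

  copy? : Dec (Copy G H)
  copy? = map′ (copy ∘ proj₂) (λ c → _ , isCopy c) (∃fun? IsCopy-resp isCopy?)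

  free? : Dec (Free G H)
  free? = ¬? copy?

  completes? : ∀ u v u≢v → Dec (Completes G H u v u≢v)
  completes? u v u≢v = map′
    (λ (f , c , used) → copy c , used)
    (λ (c , used) → _ , isCopy c , used)
    (∃fun?
      (λ f≗g (c , x , y , e , s) → IsCopy-resp f≗g c , x , y , e ,
         subst₂ (λ x′ y′ → SamePair x′ y′ u v) (f≗g x) (f≗g y) s)
      (λ f → isCopy? f ×-dec
         (Fin.any? λ x → Fin.any? λ y → _~?_ G x y ×-dec samePair? (f x) (f y) u v)))

  Addable : Fin n → Fin n → Set
  Addable u v = Σ[ u≢v ∈ u ≢ v ] ¬ _~_ H u v × ¬ Completes G H u v u≢v

  addable? : ∀ u v → Dec (Addable u v)
  addable? u v with u Fin.≟ v
  ... | yes u≡v = no λ (u≢v , _) → u≢v u≡v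
  ... | no u≢v  = map′
    (λ (u≁v , ¬c) → u≢v , u≁v , ¬c)
    (λ (_ , u≁v , ¬c) → u≁v , ¬c ∘ Completes-mono ⊑-refl (inj₁ (refl , refl)) u≁v)
    (¬? (_~?_ H u v) ×-dec ¬? (completes? u v u≢v))

  ∃addable? : Dec (∃[ u ] ∃[ v ] Addable u v)
  ∃addable? = Fin.any? λ u → Fin.any? λ v → addable? u v

  ¬addable⇒semisaturated : ¬ (∃[ u ] ∃[ v ] Addable u v) → Semisaturated G H
  ¬addable⇒semisaturated ¬a u v u≢v u≁v =
    decidable-stable (completes? u v u≢v) (λ ¬c → ¬a (u , v , u≢v , u≁v , ¬c))

  semisaturated? : Dec (Semisaturated G H)
  semisaturated? = map′ ¬addable⇒semisaturated
    (λ sat (u , v , u≢v , u≁v , ¬c) → ¬c (sat u v u≢v u≁v)) (¬? ∃addable?)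

  saturated? : Dec (Saturated G H)
  saturated? = free? ×-dec semisaturated?

  -- A copy in the enlarged graph would avoid the new edge, as `uv` completes none, and so would
  -- already lie in `H`.
  addFirst-free : ∀ {u v} → Free G H → ((u≢v , _) : Addable u v) → Free G (addFirst H u v u≢v)
  addFirst-free {u} {v} free (u≢v , _ , ¬c) c = free (copy record
    { injective = injective c′
    ; edge      = λ x y e → old e (edge c′ x y e)
    ; mono      = λ x y x′ y′ d e lt → s<s⁻¹
        (subst₂ _<_ (label-old H u≢v (unused d)) (label-old H u≢v (unused e))
          (mono c′ x y x′ y′ d e lt))
    })
    where
    c′ = isCopy c
    f = Copy.embed c

    unused : ∀ {x y} → _~_ G x y → ¬ SamePair (f x) (f y) u v
    unused e s = ¬c (c , _ , _ , e , s)

    old : ∀ {x y} → _~_ G x y → _~_ H (f x) (f y) ⊎ SamePair (f x) (f y) u v → _~_ H (f x) (f y)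
    old _ (inj₁ e′) = e′
    old e (inj₂ s)  = contradiction s (unused e)

-- Greedy saturation

pairs : ∀ n → List (Fin n × Fin n)
pairs n = cartesianProduct (allFin n) (allFin n)

∈-pairs : (x y : Fin n) → (x , y) ∈ pairs n
∈-pairs x y = ∈-cartesianProduct⁺ (∈-allFin x) (∈-allFin y)

-- Each edge counts in both orientations, so an added pair is seen whichever way round it is given.
degreeSum : EdgeOrderedGraph n → ℕ
degreeSum {n} H = length (filter (λ (x , y) → _~?_ H x y) (pairs n))

-- A pair that already completes a copy is never added, since it keeps
-- completing one when further edges are put in front.
saturate : (G : EdgeOrderedGraph m) (H : EdgeOrderedGraph n) → Free G H →
  ∃[ H′ ] Saturated G H′ ×
    (∀ u v u≢v → ¬ _~_ H u v → Completes G H u v u≢v → ¬ _~_ H′ u v)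
saturate {n = n} G H free = go (length (pairs n)) H free (m≤m+n _ _)
  where
  -- Fuel bounds the number of ordered pairs not yet adjacent: it drops by one with each new edge,
  -- while `degreeSum` grows by at least one.
  go : ∀ fuel H → Free G H → length (pairs n) ≤ fuel + degreeSum H →
       ∃[ H′ ] Saturated G H′ ×
         (∀ u v u≢v → ¬ _~_ H u v → Completes G H u v u≢v → ¬ _~_ H′ u v)
  go fuel H free bound with ∃addable? G H
  ... | no ¬a = H , (free , ¬addable⇒semisaturated G H ¬a) , λ _ _ _ u≁v _ → u≁v
  ... | yes (x , y , a@(x≢y , x≁y , ¬c)) = step fuel bound
    where
    H₁ = addFirst H x y x≢y

    grows : degreeSum H < degreeSum H₁
    grows = length-filter-mono-< (λ (x , y) → _~?_ H x y) (λ (x , y) → _~?_ H₁ x y)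
      inj₁ (∈-pairs x y) (inj₂ (inj₁ (refl , refl))) x≁y

    step : ∀ fuel → length (pairs n) ≤ fuel + degreeSum H →
       ∃[ H′ ] Saturated G H′ ×
         (∀ u v u≢v → ¬ _~_ H u v → Completes G H u v u≢v → ¬ _~_ H′ u v)
    step zero bound = contradiction
      (≤-trans grows (length-filter (λ (x , y) → _~?_ H₁ x y) (pairs n))) (≤⇒≯ bound)
    step (suc fuel) bound
      with go fuel H₁ (addFirst-free G H free a)
             (≤-trans bound (≤-trans (≤-reflexive (sym (+-suc fuel _))) (+-monoʳ-≤ fuel grows)))
    ... | H′ , sat , keeps = H′ , sat , keeps′
      where
      keeps′ : ∀ u v u≢v → ¬ _~_ H u v → Completes G H u v u≢v → ¬ _~_ H′ u v
      keeps′ u v u≢v u≁v c = keeps u v u≢v u≁₁v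
        (Completes-mono (⊑-addFirst H x≢y x≁y) (inj₁ (refl , refl)) u≁₁v c)
        where
        u≁₁v : ¬ _~_ H₁ u v
        u≁₁v (inj₁ e) = u≁v e
        u≁₁v (inj₂ s) = ¬c (Completes-mono ⊑-refl s x≁y c)

-- Minimal sizes

size-mono : {H H′ : EdgeOrderedGraph n} → H ⊑ H′ → size H ≤ size H′
size-mono {n} {H} {H′} H⊑H′ = length-filter-mono-≤
  (λ (x , y) → (x Fin.<? y) ×-dec _~?_ H x y) (λ (x , y) → (x Fin.<? y) ×-dec _~?_ H′ x y)
  (λ (x<y , e) → x<y , edge H⊑H′ _ _ e) (pairs n)

-- As for D₀, the label 0 marks the non-edges.
IsLabelling : (Fin n → Fin n → ℕ) → Set
IsLabelling l = (∀ x y → l x y ≡ l y x)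
              × (∀ x → ¬ (0 < l x x))
              × (∀ x y x′ y′ → 0 < l x y → l x y ≡ l x′ y′ → SamePair x y x′ y′)

isLabelling? : (l : Fin n → Fin n → ℕ) → Dec (IsLabelling l)
isLabelling? l =
        (Fin.all? λ x → Fin.all? λ y → l x y ≟ l y x)
  ×-dec (Fin.all? λ x → ¬? (0 <? l x x))
  ×-dec (Fin.all? λ x → Fin.all? λ y → Fin.all? λ x′ → Fin.all? λ y′ →
          (0 <? l x y) →-dec ((l x y ≟ l x′ y′) →-dec samePair? x y x′ y′))

fromLabels : (l : Fin n → Fin n → ℕ) → IsLabelling l → EdgeOrderedGraph n
fromLabels l (l-sym , l-loop , l-injective) = record
  { _~_             = λ x y → 0 < l x y
  ; _~?_            = λ x y → 0 <? l x y
  ; ~-sym           = λ {x} {y} → subst (0 <_) (l-sym x y)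
  ; ~-irrefl        = λ { {x} refl → l-loop x }
  ; label           = l
  ; label-sym       = λ {x} {y} _ → l-sym x y
  ; label-injective = λ {x} {y} {x′} {y′} d _ → l-injective x y x′ y′ d
  }

-- Replacing labels by their ranks keeps the edge order and bounds the labels in terms of `n`, which
-- leaves finitely many label matrices.
module Rank (H : EdgeOrderedGraph n) where

  below? : ∀ k ((x , y) : Fin n × Fin n) → Dec (_~_ H x y × label H x y < k)
  below? k (x , y) = _~?_ H x y ×-dec label H x y <? k

  rank : ℕ → ℕ
  rank k = length (filter (below? k) (pairs n))

  rank-mono-< : ∀ {x y k} → _~_ H x y → label H x y < k → rank (label H x y) < rank k
  rank-mono-< {x} {y} {k} e lt = length-filter-mono-< (below? (label H x y)) (below? k)
    (λ (d , lt′) → d , <-trans lt′ lt) (∈-pairs x y) (e , lt) (λ (_ , lt′) → <-irrefl refl lt′)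

  rank-injective : ∀ {x y x′ y′} → _~_ H x y → _~_ H x′ y′ →
                   rank (label H x y) ≡ rank (label H x′ y′) → label H x y ≡ label H x′ y′
  rank-injective {x} {y} {x′} {y′} d e eq with <-cmp (label H x y) (label H x′ y′)
  ... | tri< lt _ _ = contradiction (rank-mono-< d lt) (<-irrefl eq)
  ... | tri≈ _ p _  = p
  ... | tri> _ _ gt = contradiction (rank-mono-< e gt) (<-irrefl (sym eq))

  rankLabel : Fin n → Fin n → ℕ
  rankLabel x y = if does (_~?_ H x y) then suc (rank (label H x y)) else 0

  -- One successor for the shift that reserves 0 for non-edges, one for the strict inequality
  -- required by `Fin`.
  bound : ℕ
  bound = suc (suc (length (pairs n)))

  rankLabel-edge : ∀ {x y} → _~_ H x y → rankLabel x y ≡ suc (rank (label H x y))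
  rankLabel-edge {x} {y} e =
    cong (if_then suc (rank (label H x y)) else 0) (dec-true (_~?_ H x y) e)

  rankLabel-nonedge : ∀ {x y} → ¬ _~_ H x y → rankLabel x y ≡ 0
  rankLabel-nonedge {x} {y} ¬e =
    cong (if_then suc (rank (label H x y)) else 0) (dec-false (_~?_ H x y) ¬e)

  rankLabel<bound : ∀ x y → rankLabel x y < bound
  rankLabel<bound x y with _~?_ H x y
  ... | yes _ = s<s (s≤s (length-filter (below? (label H x y)) (pairs n)))
  ... | no _  = z<s

  -- A decoded matrix agrees with `rankLabel` only pointwise, hence the general `l`.
  module _ {l : Fin n → Fin n → ℕ} (eq : ∀ x y → l x y ≡ rankLabel x y) where

    l-edge : ∀ {x y} → _~_ H x y → l x y ≡ suc (rank (label H x y))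
    l-edge e = trans (eq _ _) (rankLabel-edge e)

    positive : ∀ x y → _~_ H x y → 0 < l x y
    positive x y e = subst (0 <_) (sym (l-edge e)) z<s

    adjacent : ∀ x y → 0 < l x y → _~_ H x y
    adjacent x y 0<l = decidable-stable (_~?_ H x y) λ ¬e →
      <-irrefl (sym (trans (eq x y) (rankLabel-nonedge ¬e))) 0<l

    isLabelling : IsLabelling l
    isLabelling = symmetric , (λ x → ~-irrefl H refl ∘ adjacent x x) , inj
      where
      symmetric : ∀ x y → l x y ≡ l y x
      symmetric x y with _~?_ H x y
      ... | yes e = trans (l-edge e)
        (trans (cong (suc ∘ rank) (label-sym H e)) (sym (l-edge (~-sym H e))))
      ... | no ¬e = trans (trans (eq x y) (rankLabel-nonedge ¬e))
        (sym (trans (eq y x) (rankLabel-nonedge (¬e ∘ ~-sym H))))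

      inj : ∀ x y x′ y′ → 0 < l x y → l x y ≡ l x′ y′ → SamePair x y x′ y′
      inj x y x′ y′ 0<l l≡l′ = label-injective H d e
        (rank-injective d e (suc-injective (trans (sym (l-edge d)) (trans l≡l′ (l-edge e)))))
        where
        d = adjacent x y 0<l
        e = adjacent x′ y′ (subst (0 <_) l≡l′ 0<l)

    ⊑-fromLabels : H ⊑ fromLabels l isLabelling
    ⊑-fromLabels = record
      { injective = λ _ _ p → p
      ; edge      = positive
      ; mono      = λ x y x′ y′ d e lt →
          subst₂ _<_ (sym (l-edge d)) (sym (l-edge e)) (s<s (rank-mono-< d lt))
      }

    fromLabels-⊑ : fromLabels l isLabelling ⊑ H
    fromLabels-⊑ = record
      { injective = λ _ _ p → p
      ; edge      = adjacent
      ; mono      = λ x y x′ y′ d e lt → reflect (adjacent x y d) (adjacent x′ y′ e) lt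
      }
      where
      reflect : ∀ {x y x′ y′} → _~_ H x y → _~_ H x′ y′ → l x y < l x′ y′ →
                label H x y < label H x′ y′
      reflect {x} {y} {x′} {y′} d e lt with <-cmp (label H x y) (label H x′ y′)
      ... | tri< p _ _ = p
      ... | tri≈ _ p _ = contradiction lt
        (<-irrefl (trans (l-edge d) (trans (cong (suc ∘ rank) p) (sym (l-edge e)))))
      ... | tri> _ _ p = contradiction lt
        (<-asym (subst₂ _<_ (sym (l-edge e)) (sym (l-edge d)) (s<s (rank-mono-< e p))))

Invariant : (EdgeOrderedGraph n → Set) → Set₁
Invariant P = ∀ {H H′} → H ⊑ H′ → H′ ⊑ H → P H → P H′

-- Up to order-isomorphism of the labels, there are only finitely many graphs on n vertices.
∃graph? : {P : EdgeOrderedGraph n → Set} → Invariant P → (∀ H → Dec (P H)) → Dec (∃[ H ] P H)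
∃graph? {n} {P} inv P? = map′
  (λ (_ , v , p) → _ , p)
  (λ (H , p) → code H , Rank.isLabelling H (entry-code H) ,
     inv (Rank.⊑-fromLabels H (entry-code H)) (Rank.fromLabels-⊑ H (entry-code H)) p)
  (Fin.any? valid?)
  where
  B = suc (suc (length (pairs n)))

  -- The inner power codes one row of the label matrix, the outer one the sequence of rows.
  entry : Fin ((B ^ n) ^ n) → Fin n → Fin n → ℕ
  entry i x y = toℕ (finToFun {B} {n} (finToFun {B ^ n} {n} i x) y)

  valid? : ∀ i → Dec (Σ[ v ∈ IsLabelling (entry i) ] P (fromLabels (entry i) v))
  valid? i with isLabelling? (entry i)
  ... | no ¬v = no (¬v ∘ proj₁)
  ... | yes v = map′ (v ,_) (λ (v′ , p) → inv (same v′ v) (same v v′) p) (P? (fromLabels (entry i) v))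
    where
    -- Graphs built from different proofs of `IsLabelling` are exchanged through the invariance of
    -- `P`.
    same : ∀ v′ v″ → fromLabels (entry i) v′ ⊑ fromLabels (entry i) v″
    same _ _ = record { injective = λ _ _ p → p ; edge = λ _ _ e → e ; mono = λ _ _ _ _ _ _ lt → lt }

  row : (H : EdgeOrderedGraph n) → Fin n → Fin n → Fin B
  row H x y = fromℕ< (Rank.rankLabel<bound H x y)

  code : EdgeOrderedGraph n → Fin ((B ^ n) ^ n)
  code H = funToFin (λ x → funToFin (row H x))

  entry-code : ∀ H x y → entry (code H) x y ≡ Rank.rankLabel H x y
  entry-code H x y = begin
    toℕ (finToFun {B} {n} (finToFun {B ^ n} {n} (code H) x) y)
      ≡⟨ cong (λ i → toℕ (finToFun {B} {n} i y)) (Fin.finToFun-funToFin (λ x → funToFin (row H x)) x) ⟩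
    toℕ (finToFun {B} {n} (funToFin (row H x)) y)
      ≡⟨ cong toℕ (Fin.finToFun-funToFin (row H x) y) ⟩
    toℕ (row H x y)
      ≡⟨ Fin.toℕ-fromℕ< (Rank.rankLabel<bound H x y) ⟩
    Rank.rankLabel H x y
      ∎
    where open ≡-Reasoning

-- The size of the given graph ends the search for the least attained size, and each candidate size
-- is tested by `∃graph?`.
minimumSize : {P : EdgeOrderedGraph n → Set} → Invariant P → (∀ H → Dec (P H)) →
              ∃[ H ] P H → ∃[ k ] IsMinSize P k
minimumSize {P = P} inv P? (H , p) =
  let k , attained , minimal = least sizes? (size H) (H , p , refl)
  in k , attained , λ H′ p′ → minimal (H′ , p′ , refl)
  where
  sizes? : ∀ k → Dec (∃[ H ] P H × size H ≡ k)
  sizes? k = ∃graph?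
    (λ H⊑H′ H′⊑H (p , eq) → inv H⊑H′ H′⊑H p ,
       trans (≤-antisym (size-mono H′⊑H) (size-mono H⊑H′)) eq)
    (λ H → P? H ×-dec (size H ≟ k))

module _ (G : EdgeOrderedGraph m) where

  free-invariant : Invariant {n} (Free G)
  free-invariant _ H′⊑H free c = free (copy (IsCopy-∘ H′⊑H (isCopy c)))

  semisaturated-invariant : Invariant {n} (Semisaturated G)
  semisaturated-invariant H⊑H′ _ sat u v u≢v u≁v =
    Completes-mono H⊑H′ (inj₁ (refl , refl)) u≁v (sat u v u≢v (u≁v ∘ edge H⊑H′ u v))

  saturated-invariant : Invariant {n} (Saturated G)
  saturated-invariant H⊑H′ H′⊑H (free , sat) =
    free-invariant H⊑H′ H′⊑H free , semisaturated-invariant H⊑H′ H′⊑H sat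

-- Copies of D₀ through a new edge

step-mono-< : {f : ℕ → ℕ} → (∀ i → f i < f (suc i)) → ∀ {i j} → i < j → f i < f j
step-mono-< step {i} {suc j} (s≤s i≤j) with m≤n⇒m<n∨m≡n i≤j
... | inj₁ i<j  = <-trans (step-mono-< step i<j) (step j)
... | inj₂ refl = step i

module _ {H : EdgeOrderedGraph n} (f : Fin 4 → Fin n) where
  open Diamond

  private
    L : Fin 4 → Fin 4 → ℕ
    L x y = label H (f x) (f y)

  isCopyD₀ : _~_ H (f a) (f b) → _~_ H (f a) (f v) → _~_ H (f a) (f w) →
             _~_ H (f b) (f w) → _~_ H (f b) (f v) →
             L a b < L a v → L a v < L a w → L a w < L b w → L b w < L b v →
             IsCopy D₀ H f
  isCopyD₀ ab av aw bw bv ab<av av<aw aw<bw bw<bv = record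
    { injective = inj
    ; edge      = λ x y d → proj₁ (image x y d)
    ; mono      = λ x y x′ y′ d e lt →
        subst₂ _<_ (sym (proj₂ (image x y d))) (sym (proj₂ (image x′ y′ e))) (seq-mono d lt)
    }
    where
    -- The labels of the image in increasing order, continued arbitrarily.
    seq : ℕ → ℕ
    seq 0 = L a b
    seq 1 = L a v
    seq 2 = L a w
    seq 3 = L b w
    seq (suc (suc (suc (suc i)))) = i + L b v

    step : ∀ i → seq i < seq (suc i)
    step 0 = ab<av
    step 1 = av<aw
    step 2 = aw<bw
    step 3 = bw<bv
    step (suc (suc (suc (suc i)))) = n<1+n _

    -- The labels of `D₀` start at 1 and `seq` starts at 0, hence the `pred`.
    seq-mono : ∀ {i j} → 0 < i → i < j → seq (pred i) < seq (pred j)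
    seq-mono {suc i} {suc j} _ (s<s i<j) = step-mono-< step i<j

    flip : ∀ {x y k} → _~_ H (f x) (f y) × L x y ≡ k → _~_ H (f y) (f x) × L y x ≡ k
    flip (e , eq) = ~-sym H e , trans (sym (label-sym H e)) eq

    image : ∀ x y → 0 < l x y → _~_ H (f x) (f y) × L x y ≡ seq (pred (l x y))
    image a a ()
    image a b _ = ab , refl
    image a v _ = av , refl
    image a w _ = aw , refl
    image b a _ = flip (ab , refl)
    image b b ()
    image b v _ = bv , refl
    image b w _ = bw , refl
    image v a _ = flip (av , refl)
    image v b _ = flip (bv , refl)
    image v v ()
    image v w ()
    image w a _ = flip (aw , refl)
    image w b _ = flip (bw , refl)
    image w v ()
    image w w ()

    nonadjacent : ∀ x y → ¬ (0 < l x y) → x ≡ y ⊎ SamePair x y v w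
    nonadjacent = from-yes (Fin.all? λ x → Fin.all? λ y →
      ¬? (0 <? l x y) →-dec ((x Fin.≟ y) ⊎-dec samePair? x y v w))

    fv≢fw : f v ≢ f w
    fv≢fw eq = <-irrefl (cong (label H (f a)) eq) av<aw

    -- Adjacent vertices have adjacent, hence distinct, images. The only other pair is `v`, `w`,
    -- told apart by the labels of `av` and `aw`.
    inj : ∀ x y → f x ≡ f y → x ≡ y
    inj x y eq with 0 <? l x y
    ... | yes d = contradiction (proj₁ (image x y d)) (~-irrefl H eq)
    ... | no ¬d with nonadjacent x y ¬d
    ...   | inj₁ x≡y = x≡y
    ...   | inj₂ (inj₁ (refl , refl)) = contradiction eq fv≢fw
    ...   | inj₂ (inj₂ (refl , refl)) = contradiction (sym eq) fv≢fw

-- The new edge pq plays the role of ab; the rest of the copy is a 4-cycle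
-- through p and q whose labels increase along x p y q x.
completesD₀ : (H : EdgeOrderedGraph n) {p q x y : Fin n} (p≢q : p ≢ q) → ¬ _~_ H p q →
              _~_ H p x → _~_ H p y → _~_ H q y → _~_ H q x →
              label H p x < label H p y → label H p y < label H q y →
              label H q y < label H q x → Completes D₀ H p q p≢q
completesD₀ {n} H {p} {q} {x} {y} p≢q p≁q px py qy qx px<py py<qy qy<qx =
    copy (isCopyD₀ f pq (inj₁ px) (inj₁ py) (inj₁ qy) (inj₁ qx)
      (subst₂ _<_ (sym (label-new H p≢q {p} {q} (inj₁ (refl , refl)))) (sym (old px)) z<s)
      (shift px py px<py) (shift py qy py<qy) (shift qy qx qy<qx))
  , Diamond.a , Diamond.b , z<s , inj₁ (refl , refl)
  where
  H₁ = addFirst H p q p≢q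

  f : Fin 4 → Fin n
  f Diamond.a = p
  f Diamond.b = q
  f Diamond.v = x
  f Diamond.w = y

  pq : _~_ H₁ p q
  pq = inj₂ (inj₁ (refl , refl))

  old : ∀ {z z′} → _~_ H z z′ → label H₁ z z′ ≡ suc (label H z z′)
  old e = label-old H p≢q λ s → p≁q (~-resp H s e)

  shift : ∀ {z z′ s s′} → _~_ H z z′ → _~_ H s s′ → label H z z′ < label H s s′ →
          label H₁ z z′ < label H₁ s s′
  shift d e lt = subst₂ _<_ (sym (old d)) (sym (old e)) (s<s lt)

-- The bipartite construction

combine-monoʳ-< : ∀ (i : Fin m) {j k : Fin n} → j Fin.< k → combine i j Fin.< combine i k
combine-monoʳ-< {m} {n} i {j} {k} j<k =
  subst₂ _<_ (sym (Fin.toℕ-combine i j)) (sym (Fin.toℕ-combine i k)) (+-monoʳ-< (n * toℕ i) j<k)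

splitAt-injective : ∀ t {x y : Fin (t + r)} → splitAt t x ≡ splitAt t y → x ≡ y
splitAt-injective {r} t {x} {y} eq =
  trans (sym (Fin.join-splitAt t r x)) (trans (cong (Fin.join t r) eq) (Fin.join-splitAt t r y))

-- Hubs are the first t vertices. All edges at the outer vertex i precede those
-- at i + 1, and the edges at i are ordered by key i.
module Bipartite (key : Fin r → Fin t → Fin c) where

  Joined : Fin t ⊎ Fin r → Fin t ⊎ Fin r → Set
  Joined (inj₁ _) (inj₁ _) = ⊥
  Joined (inj₁ _) (inj₂ _) = ⊤
  Joined (inj₂ _) (inj₁ _) = ⊤
  Joined (inj₂ _) (inj₂ _) = ⊥

  joined? : ∀ p q → Dec (Joined p q)
  joined? (inj₁ _) (inj₁ _) = no λ ()
  joined? (inj₁ _) (inj₂ _) = yes tt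
  joined? (inj₂ _) (inj₁ _) = yes tt
  joined? (inj₂ _) (inj₂ _) = no λ ()

  joined-sym : ∀ p q → Joined p q → Joined q p
  joined-sym (inj₁ _) (inj₂ _) _ = tt
  joined-sym (inj₂ _) (inj₁ _) _ = tt

  joined-irrefl : ∀ p → ¬ Joined p p
  joined-irrefl (inj₁ _) ()
  joined-irrefl (inj₂ _) ()

  triangle-free : ∀ p q s → Joined p q → Joined p s → ¬ Joined q s
  triangle-free (inj₁ _) (inj₂ _) (inj₂ _) _ _ ()
  triangle-free (inj₂ _) (inj₁ _) (inj₁ _) _ _ ()

  -- Lexicographic code of `i`, `key i h`, `h`; the last entry breaks ties, since several hubs may
  -- share a key.
  spoke : Fin r → Fin t → Fin (r * (c * t))
  spoke i h = combine i (combine (key i h) h)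

  spoke-injective : ∀ {i h i′ h′} → spoke i h ≡ spoke i′ h′ → i ≡ i′ × h ≡ h′
  spoke-injective {i} {h} {i′} {h′} eq =
    let i≡i′ , eq′ = Fin.combine-injective i _ i′ _ eq
    in i≡i′ , Fin.combine-injectiveʳ (key i h) h (key i′ h′) h′ eq′

  spokeLabel : Fin t ⊎ Fin r → Fin t ⊎ Fin r → ℕ
  spokeLabel (inj₁ h) (inj₂ i) = toℕ (spoke i h)
  spokeLabel (inj₂ i) (inj₁ h) = toℕ (spoke i h)
  spokeLabel _        _        = 0

  spokeLabel-sym : ∀ p q → Joined p q → spokeLabel p q ≡ spokeLabel q p
  spokeLabel-sym (inj₁ _) (inj₂ _) _ = refl
  spokeLabel-sym (inj₂ _) (inj₁ _) _ = refl

  spokeLabel-injective : ∀ p q p′ q′ → Joined p q → Joined p′ q′ →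
    spokeLabel p q ≡ spokeLabel p′ q′ → (p ≡ p′ × q ≡ q′) ⊎ (p ≡ q′ × q ≡ p′)
  spokeLabel-injective (inj₁ _) (inj₂ _) (inj₁ _) (inj₂ _) _ _ eq
    with refl , refl ← spoke-injective (Fin.toℕ-injective eq) = inj₁ (refl , refl)
  spokeLabel-injective (inj₁ _) (inj₂ _) (inj₂ _) (inj₁ _) _ _ eq
    with refl , refl ← spoke-injective (Fin.toℕ-injective eq) = inj₂ (refl , refl)
  spokeLabel-injective (inj₂ _) (inj₁ _) (inj₁ _) (inj₂ _) _ _ eq
    with refl , refl ← spoke-injective (Fin.toℕ-injective eq) = inj₂ (refl , refl)
  spokeLabel-injective (inj₂ _) (inj₁ _) (inj₂ _) (inj₁ _) _ _ eq
    with refl , refl ← spoke-injective (Fin.toℕ-injective eq) = inj₁ (refl , refl)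

  K : EdgeOrderedGraph (t + r)
  K = record
    { _~_             = λ x y → Joined (splitAt t x) (splitAt t y)
    ; _~?_            = λ x y → joined? (splitAt t x) (splitAt t y)
    ; ~-sym           = λ {x} {y} → joined-sym (splitAt t x) (splitAt t y)
    ; ~-irrefl        = λ { {x} refl → joined-irrefl (splitAt t x) }
    ; label           = λ x y → spokeLabel (splitAt t x) (splitAt t y)
    ; label-sym       = λ {x} {y} → spokeLabel-sym (splitAt t x) (splitAt t y)
    ; label-injective = λ {x} {y} {x′} {y′} d e eq →
        join (spokeLabel-injective (splitAt t x) (splitAt t y) (splitAt t x′) (splitAt t y′) d e eq)
    }
    where
    join : ∀ {x y x′ y′ : Fin (t + r)} →
           (splitAt t x ≡ splitAt t x′ × splitAt t y ≡ splitAt t y′) ⊎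
           (splitAt t x ≡ splitAt t y′ × splitAt t y ≡ splitAt t x′) → SamePair x y x′ y′
    join (inj₁ (p , q)) = inj₁ (splitAt-injective t p , splitAt-injective t q)
    join (inj₂ (p , q)) = inj₂ (splitAt-injective t p , splitAt-injective t q)

  -- The vertices `a`, `b`, `v` span a triangle in `D₀`.
  K-free : Free D₀ K
  K-free copy = triangle-free (splitAt t (f a)) (splitAt t (f b)) (splitAt t (f v))
    (edge triangle a b z<s) (edge triangle a v z<s) (edge triangle b v z<s)
    where
    open Diamond
    triangle = isCopy copy
    f = Copy.embed copy

  hub : Fin t → Fin (t + r)
  hub h = h ↑ˡ r

  outer : Fin r → Fin (t + r)
  outer i = t ↑ʳ i

  outer~hub : ∀ i h → _~_ K (outer i) (hub h)
  outer~hub i h rewrite Fin.splitAt-↑ʳ t r i | Fin.splitAt-↑ˡ t h r = tt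

  outer≁outer : ∀ i j → ¬ _~_ K (outer i) (outer j)
  outer≁outer i j rewrite Fin.splitAt-↑ʳ t r i | Fin.splitAt-↑ʳ t r j = id

  label-spoke : ∀ i h → label K (outer i) (hub h) ≡ toℕ (spoke i h)
  label-spoke i h rewrite Fin.splitAt-↑ʳ t r i | Fin.splitAt-↑ˡ t h r = refl

  Crossing : Set
  Crossing = ∀ i j → i ≢ j → ∃[ x ] ∃[ y ] key i x Fin.< key i y × key j y Fin.< key j x

  module _ (crossing : Crossing) where

    -- Around the cycle x i y j x the labels increase: at `i` and at `j` by the crossing, and from
    -- `i y` to `j y` because `i` precedes `j`.
    completes-outer-< : ∀ {i j} (p : outer i ≢ outer j) → i Fin.< j →
                        Completes D₀ K (outer i) (outer j) p
    completes-outer-< {i} {j} p i<j with crossing i j (Fin.<⇒≢ i<j)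
    ... | x , y , lt , lt′ = completesD₀ K p (outer≁outer i j)
      (outer~hub i x) (outer~hub i y) (outer~hub j y) (outer~hub j x)
      (lift i x i y (combine-monoʳ-< i (Fin.combine-monoˡ-< x y lt)))
      (lift i y j y (Fin.combine-monoˡ-< _ _ i<j))
      (lift j y j x (combine-monoʳ-< j (Fin.combine-monoˡ-< y x lt′)))
      where
      lift : ∀ i x j y → spoke i x Fin.< spoke j y →
             label K (outer i) (hub x) < label K (outer j) (hub y)
      lift i x j y = subst₂ _<_ (sym (label-spoke i x)) (sym (label-spoke j y))

    completes-outer : ∀ i j (p : outer i ≢ outer j) → Completes D₀ K (outer i) (outer j) p
    completes-outer i j p with Fin.<-cmp i j
    ... | tri< i<j _ _ = completes-outer-< p i<j
    ... | tri≈ _ i≡j _ = contradiction (cong outer i≡j) p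
    ... | tri> _ _ j<i = Completes-mono {u≢v = p ∘ sym} ⊑-refl (inj₂ (refl , refl))
                           (outer≁outer i j) (completes-outer-< (p ∘ sym) j<i)

-- Counting the edges at hubs

length-cartesianProduct : ∀ {A B : Set} (xs : List A) (ys : List B) →
                          length (cartesianProduct xs ys) ≡ length xs * length ys
length-cartesianProduct []       ys = refl
length-cartesianProduct (x ∷ xs) ys = trans (length-++ (map (x ,_) ys))
  (cong₂ _+_ (length-map (x ,_) ys) (length-cartesianProduct xs ys))

tabulate-+ : ∀ {A : Set} t (f : Fin (t + r) → A) →
             tabulate f ≡ tabulate (f ∘ (_↑ˡ r)) ++ tabulate (f ∘ (t ↑ʳ_))
tabulate-+ zero    f = refl
tabulate-+ (suc t) f = cong (f zero ∷_) (tabulate-+ t (f ∘ suc))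

-- Edges are listed with the smaller endpoint first. Hubs come before outer vertices, and no two
-- outer vertices are adjacent, so that endpoint is one of the `t` hubs.
size-sparse : ∀ t (H : EdgeOrderedGraph (t + r)) →
              (∀ i j → ¬ _~_ H (t ↑ʳ i) (t ↑ʳ j)) → size H ≤ t * (t + r)
size-sparse {r} t H ≁ = begin
  size H                                            ≡⟨ cong length split ⟩
  length (filter edge? (cartesianProduct hubs all)) ≤⟨ length-filter edge? (cartesianProduct hubs all) ⟩
  length (cartesianProduct hubs all)                ≡⟨ length-cartesianProduct hubs all ⟩
  length hubs * length all                          ≡⟨ cong₂ _*_ {length hubs} {t} {length all} {t + r}
                                                         (length-tabulate (_↑ˡ r)) (length-tabulate id) ⟩
  t * (t + r)                                       ∎
  where
  open ≤-Reasoning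
  all hubs outers : List (Fin (t + r))
  all    = allFin (t + r)
  hubs   = tabulate (_↑ˡ r)
  outers = tabulate (t ↑ʳ_)

  edge? : ∀ ((x , y) : Fin (t + r) × Fin (t + r)) → Dec (x Fin.< y × _~_ H x y)
  edge? (x , y) = (x Fin.<? y) ×-dec _~?_ H x y

  no-edge : ∀ i y → ¬ ((t ↑ʳ i) Fin.< y × _~_ H (t ↑ʳ i) y)
  no-edge i y (i<y , e) with splitAt t y in eq
  ... | inj₁ h = <-asym i<y (subst₂ _<_
    (trans (sym (Fin.toℕ-↑ˡ h r)) (cong toℕ (Fin.splitAt⁻¹-↑ˡ eq))) (sym (Fin.toℕ-↑ʳ t i))
    (≤-trans (Fin.toℕ<n h) (m≤m+n t (toℕ i))))
  ... | inj₂ j = ≁ i j (subst (_~_ H (t ↑ʳ i)) (sym (Fin.splitAt⁻¹-↑ʳ eq)) e)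

  none : All (λ (x , y) → ¬ (x Fin.< y × _~_ H x y)) (cartesianProduct outers all)
  none = All.tabulate from-outer
    where
    from-outer : ∀ {xy} → xy ∈ cartesianProduct outers all →
                 ¬ (proj₁ xy Fin.< proj₂ xy × _~_ H (proj₁ xy) (proj₂ xy))
    from-outer {x , y} xy∈ with i , refl ← ∈-tabulate⁻ (proj₁ (∈-cartesianProduct⁻ outers all xy∈)) =
      no-edge i y

  split : filter edge? (cartesianProduct all all) ≡ filter edge? (cartesianProduct hubs all)
  split = ≡-Reasoning.begin
    filter edge? (cartesianProduct all all)
      ≡-Reasoning.≡⟨ cong (λ xs → filter edge? (cartesianProduct xs all)) (tabulate-+ t id) ⟩
    filter edge? (cartesianProduct (hubs ++ outers) all)
      ≡-Reasoning.≡⟨ cong (filter edge?) (cartesianProductWith-distribʳ-++ _,_ hubs outers all) ⟩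
    filter edge? (cartesianProduct hubs all ++ cartesianProduct outers all)
      ≡-Reasoning.≡⟨ filter-++ edge? (cartesianProduct hubs all) (cartesianProduct outers all) ⟩
    filter edge? (cartesianProduct hubs all) ++ filter edge? (cartesianProduct outers all)
      ≡-Reasoning.≡⟨ cong (filter edge? (cartesianProduct hubs all) ++_) (filter-none edge? none) ⟩
    filter edge? (cartesianProduct hubs all) ++ []
      ≡-Reasoning.≡⟨ ++-identityʳ _ ⟩
    filter edge? (cartesianProduct hubs all)
      ≡-Reasoning.∎

-- Every outer pair completes a copy in `K` from the start, so the greedy process leaves it
-- unjoined.
saturated-bipartite : (key : Fin r → Fin t → Fin c) → Bipartite.Crossing key →
                      ∃[ H ] Saturated D₀ H × size H ≤ t * (t + r)
saturated-bipartite {t = t} key crossing with saturate D₀ (Bipartite.K key) (Bipartite.K-free key)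
... | H , sat , keeps = H , sat , size-sparse t H sparse
  where
  open Bipartite key
  sparse : ∀ i j → ¬ _~_ H (t ↑ʳ i) (t ↑ʳ j)
  sparse i j e = keeps _ _ i≢j (outer≁outer i j) (completes-outer crossing i j i≢j) e
    where
    i≢j : outer i ≢ outer j
    i≢j eq = ~-irrefl H eq e

-- Hubs are m dividers followed by m items; at an outer vertex with code g, the
-- item d is placed right behind the divider g d. Where two codes differ at d,
-- the larger of the two values is a divider that d crosses.
module Dividers (g : Fin r → Fin m → Fin m) where

  -- Position `2j` belongs to the divider `j`, position `2j + 1` to all items placed behind it.
  key : Fin r → Fin (m + m) → Fin (m * 2)
  key i h = [ (λ j → combine j zero) , (λ d → combine (g i d) (suc zero)) ]′ (splitAt m h)

  key-divider : ∀ i j → key i (j ↑ˡ m) ≡ combine j zero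
  key-divider i j rewrite Fin.splitAt-↑ˡ m j m = refl

  key-item : ∀ i d → key i (m ↑ʳ d) ≡ combine (g i d) (suc zero)
  key-item i d rewrite Fin.splitAt-↑ʳ m m d = refl

  item<divider : ∀ {i j d} → g i d Fin.< j → key i (m ↑ʳ d) Fin.< key i (j ↑ˡ m)
  item<divider {i} {j} {d} lt = subst₂ Fin._<_ (sym (key-item i d)) (sym (key-divider i j))
    (Fin.combine-monoˡ-< (suc zero) zero lt)

  divider<item : ∀ {i d} → key i (g i d ↑ˡ m) Fin.< key i (m ↑ʳ d)
  divider<item {i} {d} = subst₂ Fin._<_ (sym (key-divider i (g i d))) (sym (key-item i d))
    (combine-monoʳ-< (g i d) z<s)

  crossing : (∀ i j → i ≢ j → ∃[ d ] g i d ≢ g j d) → Bipartite.Crossing key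
  crossing separated i j i≢j with separated i j i≢j
  ... | d , gi≢gj with Fin.<-cmp (g i d) (g j d)
  ...   | tri< lt _ _ = m ↑ʳ d , g j d ↑ˡ m , item<divider lt , divider<item
  ...   | tri≈ _ eq _ = contradiction eq gi≢gj
  ...   | tri> _ _ gt = g i d ↑ˡ m , m ↑ʳ d , divider<item , item<divider gt

saturated-sparse : ∀ n m → n ≤ m ^ m →
  Σ[ H ∈ EdgeOrderedGraph n ] Saturated D₀ H × size H ≤ (m + m) * n
saturated-sparse n m n≤m^m with m + m ≤? n
... | yes 2m≤n with r , refl ← m≤n⇒∃[o]m+o≡n 2m≤n =
  saturated-bipartite (Dividers.key g) (Dividers.crossing g separated)
  where
  r≤m^m : r ≤ m ^ m
  r≤m^m = ≤-trans (m≤n+m r (m + m)) n≤m^m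

  -- There are `m ^ m` functions from `Fin m` to itself, enough for a different one at each outer
  -- vertex.
  g : Fin r → Fin m → Fin m
  g i = finToFun (inject≤ i r≤m^m)

  separated : ∀ i j → i ≢ j → ∃[ d ] g i d ≢ g j d
  separated i j i≢j = Fin.¬∀⟶∃¬ m _ (λ d → g i d Fin.≟ g j d)
    (λ eq → i≢j (Fin.inject≤-injective r≤m^m r≤m^m i j (finToFun-injective {m} {m} eq)))
-- With fewer than `2m` vertices all of them serve as hubs, and the bound `n * n` suffices.
... | no 2m≰n with saturated-bipartite {r = 0} {t = n} {c = 0} (λ ()) (λ ())
...   | rec rewrite +-identityʳ n = map₂ (map₂ λ s≤ → ≤-trans s≤ (*-monoˡ-≤ n (≰⇒≥ 2m≰n))) rec

-- Logarithms

n<2^[1+⌊log₂n⌋] : ∀ n → n < 2 ^ suc ⌊log₂ n ⌋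
n<2^[1+⌊log₂n⌋] n = ≰⇒> λ 2^≤n → <-irrefl refl
  (≤-trans (≤-reflexive (sym (⌊log₂[2^n]⌋≡n (suc ⌊log₂ n ⌋)))) (⌊log₂⌋-mono-≤ 2^≤n))

2*⌊n/2⌋≤n : ∀ n → 2 * ⌊ n /2⌋ ≤ n
2*⌊n/2⌋≤n n = begin
  2 * ⌊ n /2⌋           ≡⟨ cong (⌊ n /2⌋ +_) (+-identityʳ ⌊ n /2⌋) ⟩
  ⌊ n /2⌋ + ⌊ n /2⌋     ≤⟨ +-monoʳ-≤ ⌊ n /2⌋ (⌊n/2⌋≤⌈n/2⌉ n) ⟩
  ⌊ n /2⌋ + ⌈ n /2⌉     ≡⟨ ⌊n/2⌋+⌈n/2⌉≡n n ⟩
  n                     ∎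
  where open ≤-Reasoning

n≤1+2*⌊n/2⌋ : ∀ n → n ≤ suc (2 * ⌊ n /2⌋)
n≤1+2*⌊n/2⌋ 0 = z≤n
n≤1+2*⌊n/2⌋ 1 = s≤s z≤n
n≤1+2*⌊n/2⌋ (suc (suc n)) = begin
  2 + n                         ≤⟨ +-monoʳ-≤ 2 (n≤1+2*⌊n/2⌋ n) ⟩
  2 + suc (2 * ⌊ n /2⌋)         ≡⟨ cong suc (*-suc 2 ⌊ n /2⌋) ⟨
  suc (2 * suc ⌊ n /2⌋)         ∎
  where open ≤-Reasoning

-- Strong induction: for `n` at least 2, halving lowers the logarithm by exactly one.
2^⌊log₂n⌋≤n : ∀ n → 0 < n → 2 ^ ⌊log₂ n ⌋ ≤ n
2^⌊log₂n⌋≤n = <-rec _ step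
  where
  step : ∀ n → (∀ {k} → k < n → 0 < k → 2 ^ ⌊log₂ k ⌋ ≤ k) → 0 < n → 2 ^ ⌊log₂ n ⌋ ≤ n
  step 1 _ _ = ≤-refl
  step n@(suc (suc n′)) rec _ = begin
    2 ^ ⌊log₂ n ⌋              ≡⟨ cong (2 ^_) (suc-pred-log) ⟨
    2 * 2 ^ ⌊log₂ ⌊ n /2⌋ ⌋    ≤⟨ *-monoʳ-≤ 2 (rec (⌊n/2⌋<n (suc n′)) z<s) ⟩
    2 * ⌊ n /2⌋                ≤⟨ 2*⌊n/2⌋≤n n ⟩
    n                          ∎
    where
    open ≤-Reasoning
    suc-pred-log : suc ⌊log₂ ⌊ n /2⌋ ⌋ ≡ ⌊log₂ n ⌋
    suc-pred-log = trans (cong suc (⌊log₂⌊n/2⌋⌋≡⌊log₂n⌋∸1 n))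
      (m+[n∸m]≡n {1} (⌊log₂⌋-mono-≤ {2} {n} (s≤s (s≤s z≤n))))

n≤2^n : ∀ n → n ≤ 2 ^ n
n≤2^n zero    = z≤n
n≤2^n (suc n) = begin
  suc n            ≤⟨ +-mono-≤ (m^n>0 2 n) (n≤2^n n) ⟩
  2 ^ n + 2 ^ n    ≡⟨ cong (2 ^ n +_) (+-identityʳ (2 ^ n)) ⟨
  2 ^ suc n        ∎
  where open ≤-Reasoning

-- With L = ⌊log₂ n⌋, K = ⌊log₂ L⌋ and j = ⌊K/2⌋, take the first b with L < b j.
-- As 4 ^ j ≤ L, also 2 ^ j ≤ b, whence b ^ b ≥ 2 ^ (j b) > n.
logarithmic-base : ∀ n → 16 ≤ n →
  ∃[ b ] n ≤ b ^ b × b * ⌊log₂ ⌊log₂ n ⌋ ⌋ ≤ 6 * ⌊log₂ n ⌋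
logarithmic-base n 16≤n = b , n≤b^b , bK≤6L
  where
  open ≤-Reasoning
  L = ⌊log₂ n ⌋
  K = ⌊log₂ L ⌋
  j = ⌊ K /2⌋

  -- The threshold 16 is chosen so that `j` is positive and division by it makes sense.
  4≤L : 4 ≤ L
  4≤L = ⌊log₂⌋-mono-≤ 16≤n

  2≤K : 2 ≤ K
  2≤K = ⌊log₂⌋-mono-≤ 4≤L

  0<j : 0 < j
  0<j = ⌊n/2⌋-mono 2≤K

  instance
    j≢0 : NonZero j
    j≢0 = >-nonZero 0<j

  b = suc (L / j)

  2^j*2^j≤L : 2 ^ j * 2 ^ j ≤ L
  2^j*2^j≤L = begin
    2 ^ j * 2 ^ j     ≡⟨ ^-distribˡ-+-* 2 j j ⟨
    2 ^ (j + j)       ≡⟨ cong (λ i → 2 ^ (j + i)) (+-identityʳ j) ⟨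
    2 ^ (2 * j)       ≤⟨ ^-monoʳ-≤ 2 (2*⌊n/2⌋≤n K) ⟩
    2 ^ K             ≤⟨ 2^⌊log₂n⌋≤n L (≤-trans (s≤s z≤n) 4≤L) ⟩
    L                 ∎

  2^j*j≤L : 2 ^ j * j ≤ L
  2^j*j≤L = ≤-trans (*-monoʳ-≤ (2 ^ j) (n≤2^n j)) 2^j*2^j≤L

  2^j≤b : 2 ^ j ≤ b
  2^j≤b = begin
    2 ^ j             ≡⟨ m*n/n≡m (2 ^ j) j ⟨
    2 ^ j * j / j     ≤⟨ /-monoˡ-≤ j 2^j*j≤L ⟩
    L / j             ≤⟨ n≤1+n (L / j) ⟩
    b                 ∎

  L<jb : suc L ≤ j * b
  L<jb = begin
    suc L                       ≡⟨ cong suc (m≡m%n+[m/n]*n L j) ⟩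
    suc (L % j + (L / j) * j)   ≤⟨ +-monoˡ-≤ ((L / j) * j) (m%n<n L j) ⟩
    b * j                       ≡⟨ *-comm b j ⟩
    j * b                       ∎

  n≤b^b : n ≤ b ^ b
  n≤b^b = begin
    n               ≤⟨ <⇒≤ (n<2^[1+⌊log₂n⌋] n) ⟩
    2 ^ suc L       ≤⟨ ^-monoʳ-≤ 2 L<jb ⟩
    2 ^ (j * b)     ≡⟨ ^-*-assoc 2 j b ⟨
    (2 ^ j) ^ b     ≤⟨ ^-monoˡ-≤ b 2^j≤b ⟩
    b ^ b           ∎

  j≤L : j ≤ L
  j≤L = ≤-trans (m≤n*m j (2 ^ j) {{>-nonZero (m^n>0 2 j)}}) 2^j*j≤L

  -- Rounding gives `K ≤ 1 + 2 * j`, and the 1 is absorbed by the positive `j`.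
  K≤3j : K ≤ 3 * j
  K≤3j = ≤-trans (n≤1+2*⌊n/2⌋ K) (+-monoˡ-≤ (2 * j) 0<j)

  -- The 6 is the 3 from `K≤3j` times the 2 from `b * j ≤ L + L`.
  bK≤6L : b * K ≤ 6 * L
  bK≤6L = begin
    b * K                       ≤⟨ *-monoʳ-≤ b K≤3j ⟩
    b * (3 * j)                 ≡⟨ rearrange (L / j) j ⟩
    3 * (j + L / j * j)         ≤⟨ *-monoʳ-≤ 3 (+-mono-≤ j≤L (m/n*n≤m L j)) ⟩
    3 * (L + L)                 ≡⟨ double L ⟩
    6 * L                       ∎
    where
    rearrange : ∀ q j → suc q * (3 * j) ≡ 3 * (j + q * j)
    rearrange = solve-∀
    double : ∀ x → 3 * (x + x) ≡ 6 * x
    double = solve-∀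

-- The minima for `D₀` and their growth

n≤n^n : ∀ n → n ≤ n ^ n
n≤n^n zero      = z≤n
n≤n^n n@(suc k) = m≤m*n n (n ^ k) {{m^n≢0 n k}}

minimumSsat : ∀ n → ∃[ k ] Ssatₘ[ n , D₀ ]≡ k
minimumSsat n = minimumSize (semisaturated-invariant D₀) (semisaturated? D₀)
  (map₂ (proj₂ ∘ proj₁) (saturated-sparse n n (n≤n^n n)))

minimumSat : ∀ n → ∃[ k ] Satₘ[ n , D₀ ]≡ k
minimumSat n = minimumSize (saturated-invariant D₀) (saturated? D₀)
  (map₂ proj₁ (saturated-sparse n n (n≤n^n n)))

-- A smallest saturated graph is in particular semisaturated.
ssat≤sat : {G : EdgeOrderedGraph m} {j k : ℕ} → Ssatₘ[ n , G ]≡ j → Satₘ[ n , G ]≡ k → j ≤ k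
ssat≤sat (_ , minimal) ((H , (_ , semisat) , refl) , _) = minimal H semisat

-- The 12 is the 2 from the `m + m` hubs times the 6 of `logarithmic-base`.
sat-bound : ∀ {n k} → 16 ≤ n → Satₘ[ n , D₀ ]≡ k →
            k * ⌊log₂ ⌊log₂ n ⌋ ⌋ ≤ 12 * (n * ⌊log₂ n ⌋)
sat-bound {n} {k} 16≤n (_ , minimal)
  with m , n≤m^m , mK≤6L ← logarithmic-base n 16≤n
  with H , sat , size≤ ← saturated-sparse n m n≤m^m = begin
  k * K               ≤⟨ *-monoˡ-≤ K (≤-trans (minimal H sat) size≤) ⟩
  (m + m) * n * K     ≡⟨ regroup m n K ⟩
  2 * n * (m * K)     ≤⟨ *-monoʳ-≤ (2 * n) mK≤6L ⟩
  2 * n * (6 * L)     ≡⟨ collect n L ⟩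
  12 * (n * L)        ∎
  where
  open ≤-Reasoning
  L = ⌊log₂ n ⌋
  K = ⌊log₂ L ⌋
  regroup : ∀ x y z → (x + x) * y * z ≡ 2 * y * (x * z)
  regroup = solve-∀
  collect : ∀ x y → 2 * x * (6 * y) ≡ 12 * (x * y)
  collect = solve-∀

theorem23 : Σ[ ssat ∈ (ℕ → ℕ) ] Σ[ sat ∈ (ℕ → ℕ) ]
    (∀ n → Ssatₘ[ n , D₀ ]≡ ssat n)
    × (∀ n → Satₘ[ n , D₀ ]≡ sat n)
    × (∀ n → ssat n ≤ sat n)
    × sat =O[ (λ n → n * ⌊log₂ n ⌋) / (λ n → ⌊log₂ ⌊log₂ n ⌋ ⌋) ]
theorem23 =
    proj₁ ∘ minimumSsat
  , proj₁ ∘ minimumSat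
  , proj₂ ∘ minimumSsat
  , proj₂ ∘ minimumSat
  , (λ n → ssat≤sat (proj₂ (minimumSsat n)) (proj₂ (minimumSat n)))
  , 12 , 16 , λ n 16≤n →
      -- The denominator is at least `⌊log₂ 2 ⌋`, which is 1, because `⌊log₂ n ⌋` is at least 4.
      ≤-trans z<s (⌊log₂⌋-mono-≤ {2} (≤-trans (s≤s (s≤s z≤n)) (⌊log₂⌋-mono-≤ {16} 16≤n)))
    , sat-bound 16≤n (proj₂ (minimumSat n))
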